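{- Let $n\ge 1$ and $u,w\in\mathfrak{W}_n$. If $\mathcal{W}(u)=\mathcal{W}(w)$, then $u\sim_{rid} w$.
   Context: Partitions are identified with Young diagrams in English notation; box $(i,j)$ lies in row $i$ (from the top) and column $j$ (from the left). For partitions $\lambda\subseteq\mu$, an increasing tableau of skew shape $\mu/\lambda$ is a filling of the boxes of $\mu/\lambda$ by positive integers that strictly increase left to right along rows and top to bottom along columns; $\mathrm{Inc}(\mu/\lambda)$ is the set of these. Let $\sigma_n=(n,n-1,\dots,1)$ and let $M_n\in\mathrm{Inc}(\sigma_n)$ be the minimal tableau, with entry $i+j-1$ in box $(i,j)$ ($M_0$ is empty). An inner corner of $\mu/\lambda$ is a box of $\lambda$ with no box of $\lambda$ immediately to its right or immediately below it. K-jeu de taquin: for $T\in\mathrm{Inc}(\mu/\lambda)$ and a set $B$ of inner corners, $\mathrm{jdt}_B(T)$ is obtained by placing a dot in each box of $B$ and then, for $i=1,2,\dots$ up to the largest entry of $T$: simultaneously, every dot that has a box containing $i$ immediately below it or immediately to its right is replaced by $i$, and every such box containing $i$ (i.e. with a dot immediately above it or immediately to its left) is replaced by a dot; finally the dots are deleted. For $T\in\mathrm{Inc}(\lambda)$ (straight shape) with largest entry $k$ and $U\in\mathrm{Inc}(\mu/\lambda)$, let $B_i$ be the set of boxes of $T$ containing $i$, put $U_k=U$, $U_{i-1}=\mathrm{jdt}_{B_i}(U_i)$ for $i=k,\dots,1$, and $\mathrm{jdt}_T(U)=U_0$. $\mathfrak{W}_n$ is the set of words of length $n$ with positive integer letters;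 a word $w\in\mathfrak{W}_n$ is identified with the increasing tableau of shape $\sigma_n/\sigma_{n-1}$ having $w_i$ in box $(n+1-i,i)$. Define $\mathcal{W}(w)=\mathrm{jdt}_{M_{n-1}}(w)$ (this is the first component of the K-infusion of $(M_{n-1},w)$). For a word $x$, $\mathrm{lis}(x)$ and $\mathrm{lds}(x)$ are the lengths of a longest strictly increasing, resp. strictly decreasing, subsequence of $x$. Words $u,w$ satisfy $u\sim_{rid} w$ if for every integer interval $[a,b]$, letting $u',w'$ be obtained from $u,w$ by deleting all letters not in $[a,b]$, we have $\mathrm{lis}(u')=\mathrm{lis}(w')$ and $\mathrm{lds}(u')=\mathrm{lds}(w')$. -}

module Defs where

open import Data.Nat using (ℕ; zero; suc; _∸_; _⊔_; _≡ᵇ_; _<ᵇ_; _≤ᵇ_)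
open import Data.Bool using (Bool; true; false; _∧_; _∨_; if_then_else_)
open import Data.List using (List; []; _∷_; length; map; filter; _++_; foldr)
open import Data.Vec using (Vec; toList)
open import Relation.Binary.PropositionalEquality using (_≡_)
open import Relation.Nullary.Decidable using (T?)
open import Data.Bool using (T)
open import Data.Product using (_×_)

-- Fillings of the plane.  Boxes are (row , column), 1-indexed as in the
-- paper (row 0 / column 0 are never used and stay empty).  A (skew)
-- tableau is represented by the function giving the content of each box:
-- ∅ (box not in the skew shape), ● (a dot during a slide), or val k.

data Cell : Set where
  ∅   : Cell
  ●   : Cell
  val : ℕ → Cell

Tab : Set
Tab = ℕ → ℕ → Cell

isVal : ℕ → Cell → Bool
isVal i (val k) = k ≡ᵇ i
isVal i _       = false

isDot : Cell → Bool
isDot ● = true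
isDot _ = false

above : Tab → ℕ → ℕ → Cell
above t zero    c = ∅
above t (suc r) c = t r c

leftOf : Tab → ℕ → ℕ → Cell
leftOf t r zero    = ∅
leftOf t r (suc c) = t r c

stepCell : ℕ → Tab → ℕ → ℕ → Cell → Cell
stepCell i t r c ∅       = ∅
stepCell i t r c ●       =
  if isVal i (t (suc r) c) ∨ isVal i (t r (suc c)) then val i else ●
stepCell i t r c (val k) =
  if (k ≡ᵇ i) ∧ (isDot (above t r c) ∨ isDot (leftOf t r c)) then ● else val k

step : ℕ → Tab → Tab
step i t r c = stepCell i t r c (t r c)

slides : ℕ → Tab → Tab
slides zero    t = t
slides (suc K) t = step (suc K) (slides K t)

placeDots : (ℕ → ℕ → Bool) → Tab → Tab
placeDots B t r c = if B r c then ● else t r c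

deleteDots : Tab → Tab
deleteDots t r c with t r c
... | ● = ∅
... | x = x

-- jdt_B(T), where K is the largest entry of T (steps with i > largest
-- entry are no-ops)
jdtB : (ℕ → ℕ → Bool) → ℕ → Tab → Tab
jdtB B K t = deleteDots (slides K (placeDots B t))

-- jdt_T(U) for a straight tableau T with largest entry k;
-- K is the largest entry of U.
-- U_k = U, U_{i-1} = jdt_{B_i}(U_i), result U_0.
jdtT : Tab → ℕ → ℕ → Tab → Tab
jdtT T zero    K U = U
jdtT T (suc i) K U = jdtT T i K (jdtB (λ r c → isVal (suc i) (T r c)) K U)

-- minimal tableau M_m of staircase shape σ_m = (m, m-1, …, 1):
-- entry r + c - 1 in box (r , c), boxes with r , c ≥ 1 and r + c ≤ m + 1
minTab : ℕ → Tab
minTab m zero    c       = ∅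
minTab m (suc r) zero    = ∅
minTab m (suc r) (suc c) =
  if suc r Data.Nat.+ c ≤ᵇ m then val (suc r Data.Nat.+ c) else ∅
  -- box (r+1, c+1): entry (r+1)+(c+1)-1 = r+c+1, present iff r+c+2 ≤ m+1

nth : List ℕ → ℕ → ℕ
nth []       _       = 0
nth (x ∷ xs) zero    = x
nth (x ∷ xs) (suc i) = nth xs i

-- the word w ∈ 𝔚_n as a tableau of shape σ_n/σ_{n-1}:
-- w_i (1-indexed) in box (n+1-i , i)
wordTab : (n : ℕ) → Vec ℕ n → Tab
wordTab n w r zero      = ∅
wordTab n w r (suc c′) =
  if (c′ <ᵇ n) ∧ (r ≡ᵇ (n ∸ c′)) then val (nth (toList w) c′) else ∅

maxList : List ℕ → ℕ
maxList = foldr _⊔_ 0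

𝒲 : (n : ℕ) → Vec ℕ n → Tab
𝒲 n w = jdtT (minTab (n ∸ 1)) (n ∸ 1) (maxList (toList w)) (wordTab n w)

subsequences : List ℕ → List (List ℕ)
subsequences []       = [] ∷ []
subsequences (x ∷ xs) = map (x ∷_) (subsequences xs) ++ subsequences xs

strictlyInc : List ℕ → Bool
strictlyInc []             = true
strictlyInc (x ∷ [])       = true
strictlyInc (x ∷ y ∷ xs)   = (x <ᵇ y) ∧ strictlyInc (y ∷ xs)

strictlyDec : List ℕ → Bool
strictlyDec []             = true
strictlyDec (x ∷ [])       = true
strictlyDec (x ∷ y ∷ xs)   = (y <ᵇ x) ∧ strictlyDec (y ∷ xs)

lis : List ℕ → ℕ
lis x = maxList (map length (filter (λ s → T? (strictlyInc s)) (subsequences x)))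

lds : List ℕ → ℕ
lds x = maxList (map length (filter (λ s → T? (strictlyDec s)) (subsequences x)))

restrict : ℕ → ℕ → List ℕ → List ℕ
restrict a b = filter (λ x → T? ((a ≤ᵇ x) ∧ (x ≤ᵇ b)))

_∼rid_ : List ℕ → List ℕ → Set
u ∼rid w = ∀ (a b : ℕ) →
  (lis (restrict a b u) ≡ lis (restrict a b w)) × (lds (restrict a b u) ≡ lds (restrict a b w))

{-# OPTIONS --safe #-}
-- Call a path in an increasing tableau a sequence of boxes whose rows weakly
-- decrease and whose values strictly increase.  In the tableau of a word the paths
-- are the increasing subsequences, in its transpose the decreasing ones (read
-- backwards), so it suffices that K-jeu de taquin U ↦ U′ preserves the lengths
-- of paths with values in a given interval.
--
-- A value of U either keeps its box, moves one box left, or moves one box up, and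
-- U′(r,c) ≤ U(r+1,c).  Hence a path of U can be followed in U′ by staying in the row
-- as long as no value of the current row segment moves up, and by
-- replacing the rest of the segment by the boxes right above it once one does.
-- The converse is the same argument run from the end of the path.
module Submission where

open import Defs
open import Data.Nat
open import Data.Nat.Properties
open import Data.Bool using (Bool; true; false; T; _∧_; if_then_else_)
open import Data.Bool.Properties using (T-≡; T-∧)
open import Data.List using (List; []; _∷_; length; map; filter; drop)
open import Data.List.Membership.Propositional using (_∈_)
open import Data.List.Membership.Propositional.Properties
  using (∈-map⁺; ∈-map⁻; ∈-filter⁺; ∈-filter⁻; ∈-++⁺ˡ; ∈-++⁺ʳ; ∈-++⁻)
open import Data.List.Properties using (filter-all)
open import Data.List.Relation.Unary.Any using (here; there)
open import Data.List.Relation.Unary.All as ListAll using ([]; _∷_)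
open import Data.List.Relation.Unary.AllPairs using (AllPairs; []; _∷_)
open import Data.List.Relation.Unary.Linked using (Linked; []; [-]; _∷_)
open import Data.List.Relation.Unary.Linked.Properties
  using (Linked⇒AllPairs; AllPairs⇒Linked)
open import Data.List.Relation.Binary.Sublist.Propositional
  using (_⊆_; []; _∷_; _∷ʳ_; minimum; ⊆-trans)
open import Data.List.Relation.Binary.Sublist.Propositional.Properties
  using (filter-⊆; filter⁺; drop⁺-≥; All-resp-⊆)
open import Data.List.Relation.Unary.All.Properties using (all-filter)
open import Data.Vec using (Vec; []; _∷_; toList)
open import Data.Vec.Properties using (length-toList)
open import Data.Vec.Relation.Unary.All using (All; []; _∷_)
open import Data.Product using (_×_; _,_; ∃; proj₁; proj₂; map₁; map₂)
open import Data.Sum as Sum using (_⊎_; inj₁; inj₂; swap)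
open import Data.Empty using (⊥; ⊥-elim)
open import Data.Unit using (⊤; tt)
open import Function using (flip; _∘_; id)
open import Function.Bundles using (Equivalence)
open import Relation.Nullary using (¬_; contradiction)
open import Relation.Nullary.Decidable using (T?)
open import Relation.Binary.Definitions using (tri<; tri≈; tri>)
open import Relation.Binary.PropositionalEquality hiding (J)

-- Paths in a tableau and their transport through a slide.

val-injective : ∀ {j k} → val j ≡ val k → j ≡ k
val-injective refl = refl

-- `r` and `l` only bound the first box, so a path can be weakened. Columns are left free: a value
-- that moves left within its row remains the same step of the path.
data Path (b : ℕ) (U : Tab) : (r l k : ℕ) → Set where
  []   : ∀ {r l} → Path b U r l 0
  cons : ∀ {r l k r′ c v} → U r′ c ≡ val v → r′ ≤ r → l ≤ v → v ≤ b →
         Path b U r′ (suc v) k → Path b U r l (suc k)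

weaken : ∀ {b U r l r′ l′ k} → r ≤ r′ → l′ ≤ l → Path b U r l k → Path b U r′ l′ k
weaken r≤ l≤ []                 = []
weaken r≤ l≤ (cons e p q v≤b π) = cons e (≤-trans p r≤) (≤-trans l≤ q) v≤b π

path-cong : ∀ {b U V r l k} → (∀ r c → U r c ≡ V r c) → Path b U r l k → Path b V r l k
path-cong U≗V []               = []
path-cong U≗V (cons e p q s π) = cons (trans (sym (U≗V _ _)) e) p q s (path-cong U≗V π)

RowStrict : Tab → Set
RowStrict U = ∀ {r c c′ v v′} → U r c ≡ val v → U r c′ ≡ val v′ → c < c′ → v < v′

-- The facts about a slide on which the path argument rests. Staying and moving left are merged, as
-- paths do not see columns. Decreasing subsequences use a second instance, for the transposes.
record RowSlide (U U′ : Tab) : Set where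
  field
    strict   : RowStrict U
    strict′  : RowStrict U′
    forth    : ∀ {r c v} → U r c ≡ val v →
               (∃ λ c₀ → U′ r c₀ ≡ val v) ⊎ (∃ λ r₀ → r ≡ suc r₀ × U′ r₀ c ≡ val v)
    back     : ∀ {r c v} → U′ r c ≡ val v →
               (∃ λ c₀ → U r c₀ ≡ val v) ⊎ U (suc r) c ≡ val v
    above-≤  : ∀ {r c v u} → U′ r c ≡ val v → U (suc r) c ≡ val u → v ≤ u
    above-∃  : ∀ {r c₀ c v u} → U′ r c₀ ≡ val v → U (suc r) c ≡ val u → c₀ < c →
               ∃ λ v′ → U′ r c ≡ val v′
    below-∃  : ∀ {r c c₀ v u} → U′ r c ≡ val v → U (suc r) c₀ ≡ val u → c < c₀ →
               ∃ λ u′ → U (suc r) c ≡ val u′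

strict-reflects : ∀ U {r c c′ v v′} → RowStrict U →
                  U r c ≡ val v → U r c′ ≡ val v′ → v < v′ → c < c′
strict-reflects U {c = c} {c′} str e e′ v<v′ with <-cmp c c′
... | tri< c<c′ _ _ = c<c′
... | tri≈ _ refl _ = contradiction (val-injective (trans (sym e) e′)) (<⇒≢ v<v′)
... | tri> _ _ c>c′ = contradiction (str e′ e c>c′) (<⇒≯ v<v′)

module _ {U U′ : Tab} (S : RowSlide U U′) {b : ℕ} where
  open RowSlide S

  mutual
    path-forth : ∀ {r l k} → Path b U r l k → Path b U′ r l k
    path-forth []               = []
    path-forth (cons e p q s π) = cons-forth e p q s π

    cons-forth : ∀ {r l k r′ c v} → U r′ c ≡ val v → r′ ≤ r → l ≤ v → v ≤ b →
                 Path b U r′ (suc v) k → Path b U′ r l (suc k)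
    cons-forth e p q s π with forth e
    ... | inj₁ (_ , e′)        = cons e′ p q s (path-forth π)
    ... | inj₂ (_ , refl , e′) =
      cons e′ (≤-trans (n≤1+n _) p) q s (path-forth-up e e′ ≤-refl π)

    -- Once `u` has been replaced by `v` above it, the rest of the segment in row `suc r` shifts up
    -- too: `above-∃` fills the boxes above, `above-≤` keeps them within `b`, and `strict′` makes
    -- them increase.
    path-forth-up : ∀ {r c u v k} → U (suc r) c ≡ val u → U′ r c ≡ val v → v ≤ u →
                    Path b U (suc r) (suc u) k → Path b U′ r (suc v) k
    path-forth-up _ _ _ [] = []
    path-forth-up e e′ v≤u (cons f p q s π) with m≤n⇒m<n∨m≡n p
    -- The path leaves row `suc r`, so its next box lies in row `r` or above and can be followed
    -- afresh; its value exceeds `u`, hence `v`.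
    ... | inj₁ (s≤s p′) = weaken ≤-refl (s≤s v≤u) (cons-forth f p′ q s π)
    ... | inj₂ refl =
      let c<    = strict-reflects U strict e f q
          _ , h = above-∃ e′ f c<
      in cons h ≤-refl (strict′ e′ h c<) (≤-trans (above-≤ h f) s)
           (path-forth-up f h (above-≤ h f) π)

  -- The second alternative: the first box of the path, in row r itself, has been
  -- replaced by the box below it, so that the preceding boxes of row r must be too.
  Followed : (r l k : ℕ) → Set
  Followed r l k = Path b U r l k ⊎
    (∃ λ c → ∃ λ v → ∃ λ u → ∃ λ k′ → k ≡ suc k′ × U′ r c ≡ val v × U (suc r) c ≡ val u ×
      l ≤ v × v ≤ u × u ≤ b × Path b U (suc r) (suc u) k′)

  -- The box below is itself admissible if `r′ < r`; only for `r′ ≡ r` does it fall one row too low,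
  -- which is the second alternative.
  followed-down : ∀ {r r′ c l v u k} → r′ ≤ r → U′ r′ c ≡ val v → U (suc r′) c ≡ val u →
                  l ≤ v → v ≤ u → u ≤ b → Path b U (suc r′) (suc u) k → Followed r l (suc k)
  followed-down r′≤r e f l≤v v≤u u≤b π with m≤n⇒m<n∨m≡n r′≤r
  ... | inj₁ r′<r = inj₁ (cons f r′<r (≤-trans l≤v v≤u) u≤b π)
  ... | inj₂ refl = inj₂ (_ , _ , _ , _ , refl , e , f , l≤v , v≤u , u≤b , π)

  follow : ∀ {r l k} → Path b U′ r l k → Followed r l k
  follow [] = inj₁ []
  follow (cons e p q s π) with follow π
  -- The next box is in the same row and has been lowered. The current one lies to its left, so
  -- `below-∃` supplies a value below it, and `strict` keeps the lowered segment increasing.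
  ... | inj₂ (_ , _ , _ , _ , refl , e₁ , f₁ , v<v₁ , _ , u₁≤b , π₁) =
    let c<    = strict-reflects U′ strict′ e e₁ v<v₁
        _ , f = below-∃ e f₁ c<
        u<u₁  = strict f f₁ c<
    in followed-down p e f q (above-≤ e f) (≤-trans (<⇒≤ u<u₁) u₁≤b)
         (cons f₁ ≤-refl u<u₁ u₁≤b π₁)
  ... | inj₁ π₁ with back e
  ...   | inj₁ (_ , f) = inj₁ (cons f p q s π₁)
  ...   | inj₂ f       = followed-down p e f q ≤-refl s (weaken (n≤1+n _) ≤-refl π₁)

  -- The extra row pays for a first box lowered out of row `r`; it is harmless in `HasPath`, where
  -- the row bound is existential.
  path-back : ∀ {r l k} → Path b U′ r l k → Path b U (suc r) l k
  path-back π with follow π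
  ... | inj₁ π′ = weaken (n≤1+n _) ≤-refl π′
  ... | inj₂ (_ , _ , _ , _ , refl , _ , f , q , v≤u , u≤b , π′) =
    cons f ≤-refl (≤-trans q v≤u) u≤b π′

HasPath : ℕ → ℕ → ℕ → Tab → Set
HasPath a b k U = ∃ λ r → Path b U r a k

_≈ₚ_ : Tab → Tab → Set
U ≈ₚ V = ∀ a b k → (HasPath a b k U → HasPath a b k V) × (HasPath a b k V → HasPath a b k U)

≈ₚ-trans : ∀ {U V W} → U ≈ₚ V → V ≈ₚ W → U ≈ₚ W
≈ₚ-trans p q a b k =
  proj₁ (q a b k) ∘ proj₁ (p a b k) , proj₂ (p a b k) ∘ proj₂ (q a b k)

RowSlide⇒≈ₚ : ∀ {U U′} → RowSlide U U′ → U ≈ₚ U′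
RowSlide⇒≈ₚ S a b k = (λ (_ , π) → _ , path-forth S π) , (λ (_ , π) → _ , path-back S π)

-- The single steps of a slide and their invariant.

Before : (ℕ → Set) → ℕ → Set
Before P n = ∃ λ m → n ≡ suc m × P m

DotBefore : Tab → ℕ → ℕ → Set
DotBefore t r c = Before (λ r₀ → t r₀ c ≡ ●) r ⊎ Before (λ c₀ → t r c₀ ≡ ●) c

ValAfter : ℕ → Tab → ℕ → ℕ → Set
ValAfter i t r c = t (suc r) c ≡ val i ⊎ t r (suc c) ≡ val i

-- One step as a relation, with the Boolean tests replaced by propositions symmetric under
-- transposition. Facts proved for rows thus transfer to columns by `flip`.
data View (i : ℕ) (t : Tab) (r c : ℕ) : Cell → Cell → Set where
  empty   : View i t r c ∅ ∅
  dotStay : ¬ ValAfter i t r c → View i t r c ● ●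
  dotFill : ValAfter i t r c → View i t r c ● (val i)
  valStay : ∀ {k} → (k ≡ i → ¬ DotBefore t r c) → View i t r c (val k) (val k)
  valMove : DotBefore t r c → View i t r c (val i) ●

Step : ℕ → Tab → Tab → Set
Step i t t′ = ∀ r c → View i t r c (t r c) (t′ r c)

isVal-true : ∀ i x → isVal i x ≡ true → x ≡ val i
isVal-true i (val k) e = cong val (≡ᵇ⇒≡ k i (Equivalence.from T-≡ e))

isVal-val : ∀ i → isVal i (val i) ≡ true
isVal-val i = Equivalence.to T-≡ (≡⇒≡ᵇ i i refl)

isDot-true : ∀ x → isDot x ≡ true → x ≡ ●
isDot-true ● _ = refl

above-● : ∀ t r c → above t r c ≡ ● → Before (λ r₀ → t r₀ c ≡ ●) r
above-● t (suc r) c e = r , refl , e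

leftOf-● : ∀ t r c → leftOf t r c ≡ ● → Before (λ c₀ → t r c₀ ≡ ●) c
leftOf-● t r (suc c) e = c , refl , e

false≢true : ∀ {x} → x ≡ false → x ≢ true
false≢true refl ()

step-view : ∀ i t r c → View i t r c (t r c) (step i t r c)
step-view i t r c = view (t r c)
  where
  view : ∀ x → View i t r c x (stepCell i t r c x)
  view ∅ = empty
  view ● with isVal i (t (suc r) c) in e₁ | isVal i (t r (suc c)) in e₂
  ... | true  | _     = dotFill (inj₁ (isVal-true i _ e₁))
  ... | false | true  = dotFill (inj₂ (isVal-true i _ e₂))
  ... | false | false = dotStay λ where
    (inj₁ e) → false≢true e₁ (trans (cong (isVal i) e) (isVal-val i))
    (inj₂ e) → false≢true e₂ (trans (cong (isVal i) e) (isVal-val i))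
  view (val k) with k ≡ᵇ i in e
  ... | false = valStay λ { refl → contradiction (isVal-val k) (false≢true e) }
  ... | true with ≡ᵇ⇒≡ k i (Equivalence.from T-≡ e)
  ...   | refl with isDot (above t r c) in e₁ | isDot (leftOf t r c) in e₂
  ...     | true  | _     = valMove (inj₁ (above-● t r c (isDot-true _ e₁)))
  ...     | false | true  = valMove (inj₂ (leftOf-● t r c (isDot-true _ e₂)))
  ...     | false | false = valStay λ where
    _ (inj₁ (_ , refl , d)) → false≢true e₁ (cong isDot d)
    _ (inj₂ (_ , refl , d)) → false≢true e₂ (cong isDot d)

View-flip : ∀ {i t r c x y} → View i t r c x y → View i (flip t) c r x y
View-flip empty       = empty
View-flip (dotStay p) = dotStay (p ∘ swap)
View-flip (dotFill p) = dotFill (swap p)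
View-flip (valStay p) = valStay λ e → p e ∘ swap
View-flip (valMove p) = valMove (swap p)

Step-flip : ∀ {i t t′} → Step i t t′ → Step i (flip t) (flip t′)
Step-flip s r c = View-flip (s c r)

-- The order of the cells after step i, at which time a dot counts as i + ½.
Lt : ℕ → Cell → Cell → Set
Lt i ∅       _       = ⊤
Lt i ●       ∅       = ⊤
Lt i ●       ●       = ⊥
Lt i ●       (val k) = i < k
Lt i (val j) ∅       = ⊤
Lt i (val j) ●       = j ≤ i
Lt i (val j) (val k) = j < k

RowInc : ℕ → Tab → Set
RowInc i t = ∀ r c → Lt i (t r c) (t r (suc c))

-- Only comparisons with a dot or with `suc i` can change. A dot left of `suc i` fills while `suc i`
-- becomes a dot, so a dot that stays has only a larger value to its right, and a filled dot is less
-- than a value that stays there.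
RowInc-step : ∀ {i t t′} → Step (suc i) t t′ → RowInc i t → RowInc (suc i) t′
RowInc-step {i} {t} s inc r c = go (s r c) (s r (suc c)) refl refl (inc r c)
  where
  go : ∀ {x x′ y y′} → View (suc i) t r c x x′ → View (suc i) t r (suc c) y y′ →
       t r c ≡ x → t r (suc c) ≡ y → Lt i x y → Lt (suc i) x′ y′
  go empty       _           _ _ _  = tt
  go (dotStay _) empty       _ _ _  = tt
  go (dotFill _) empty       _ _ _  = tt
  go (valStay _) empty       _ _ _  = tt
  go (valMove _) empty       _ _ _  = tt
  go (dotStay _) (dotStay _) _ _ ()
  go (dotStay _) (dotFill _) _ _ ()
  go (dotFill _) (dotStay _) _ _ ()
  go (dotFill _) (dotFill _) _ _ ()
  go (dotStay p) (valStay _) _ f lt = ≤∧≢⇒< lt λ { refl → p (inj₂ f) }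
  go (dotFill _) (valStay q) e _ lt =
    ≤∧≢⇒< lt λ { refl → q refl (inj₂ (_ , refl , e)) }
  go (dotStay p) (valMove _) _ f _  = contradiction (inj₂ f) p
  go (dotFill _) (valMove _) _ _ _  = ≤-refl
  go (valStay _) (dotStay _) _ _ lt = m≤n⇒m≤1+n lt
  go (valStay _) (dotFill _) _ _ lt = s≤s lt
  go (valMove _) (dotStay _) _ _ lt = contradiction lt (n≮n _)
  go (valMove _) (dotFill _) _ _ lt = contradiction lt (n≮n _)
  go (valStay _) (valStay _) _ _ lt = lt
  go (valStay _) (valMove _) _ _ lt = <⇒≤ lt
  go (valMove _) (valStay _) _ _ lt = lt
  go (valMove _) (valMove _) _ _ lt = contradiction lt (n≮n _)

-- `t₀` is the tableau with its dots placed, `t` its state after step `i`. The conjuncts `v ≤ i` say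
-- that only processed values have moved; step `suc i` moves nothing but `suc i`, so each value
-- moves at most once. Dots count as part of the shape.
record Inv (i : ℕ) (t₀ t : Tab) : Set where
  field
    rowInc  : RowInc i t
    colInc  : RowInc i (flip t)
    forth   : ∀ {r c v} → t₀ r c ≡ val v → t r c ≡ val v ⊎
              (v ≤ i × (Before (λ r₀ → t r₀ c ≡ val v) r ⊎ Before (λ c₀ → t r c₀ ≡ val v) c))
    back    : ∀ {r c v} → t r c ≡ val v → t₀ r c ≡ val v ⊎ (v ≤ i × ValAfter v t₀ r c)
    above-≤ : ∀ {r c v u} → t r c ≡ val v → t₀ (suc r) c ≡ val u → v ≤ u
    left-≤  : ∀ {r c v u} → t r c ≡ val v → t₀ r (suc c) ≡ val u → v ≤ u
    shape   : ∀ {r c} → t r c ≡ ∅ → t₀ r c ≡ ∅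
    shape⁻  : ∀ {r c} → t₀ r c ≡ ∅ → t r c ≡ ∅

Inv-flip : ∀ {i t₀ t} → Inv i t₀ t → Inv i (flip t₀) (flip t)
Inv-flip I = record
  { rowInc = colInc ; colInc = rowInc
  ; forth = λ e → Sum.map₂ (map₂ swap) (forth e)
  ; back = λ e → Sum.map₂ (map₂ swap) (back e)
  ; above-≤ = left-≤ ; left-≤ = above-≤ ; shape = shape ; shape⁻ = shape⁻ }
  where open Inv I

Inv-init : ∀ {t} → RowInc 0 t → RowInc 0 (flip t) → Inv 0 t t
Inv-init {t} inc incᵀ = record
  { rowInc = inc ; colInc = incᵀ ; forth = inj₁ ; back = inj₁
  ; above-≤ = λ e f → <⇒≤ (subst₂ (Lt 0) e f (incᵀ _ _))
  ; left-≤ = λ e f → <⇒≤ (subst₂ (Lt 0) e f (inc _ _))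
  ; shape = λ e → e ; shape⁻ = λ e → e }

-- The box to the right of a dot has not been touched so far, since a value
-- written by the slide is at most i.
dot-≤-right : ∀ {i t₀ t r c u} → Inv i t₀ t → t r c ≡ ● → t₀ r (suc c) ≡ val u → suc i ≤ u
dot-≤-right {t = t} {r} {c} I d f with t r (suc c) in e | Inv.rowInc I r c
... | ∅ | _ rewrite d with () ← trans (sym f) (Inv.shape I e)
... | ● | lt rewrite d = ⊥-elim lt
... | val k | lt rewrite d with Inv.back I e
...   | inj₁ g with refl ← val-injective (trans (sym f) g) = lt
...   | inj₂ (k≤i , _) = contradiction lt (≤⇒≯ k≤i)

val-persists : ∀ {i t t′ r c v} → Step (suc i) t t′ → v ≤ i → t r c ≡ val v → t′ r c ≡ val v
val-persists {i} {t} {t′} {r} {c} s v≤i e with t r c | t′ r c | s r c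
val-persists s v≤i refl | _ | _ | valStay _ = refl
val-persists s v≤i refl | _ | _ | valMove _ = contradiction v≤i (n≮n _)

dot-fills : ∀ {i t t′ r c} → Step i t t′ → t r c ≡ ● → ValAfter i t r c → t′ r c ≡ val i
dot-fills {i} {t} {t′} {r} {c} s e a with t r c | t′ r c | s r c
dot-fills s refl a | _ | _ | dotStay p = contradiction a p
dot-fills s refl a | _ | _ | dotFill _ = refl

val-before : ∀ {i t t′ r c v} → Step i t t′ → t′ r c ≡ val v →
             t r c ≡ val v ⊎ (v ≡ i × t r c ≡ ● × ValAfter i t r c)
val-before {i} {t} {t′} {r} {c} s e with t r c | t′ r c | s r c
val-before s refl | _ | _ | dotFill a = inj₂ (refl , refl , a)
val-before s refl | _ | _ | valStay _ = inj₁ refl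

val-after : ∀ {i t t′ r c v} → Step i t t′ → t r c ≡ val v →
            t′ r c ≡ val v ⊎ (v ≡ i × DotBefore t r c)
val-after {i} {t} {t′} {r} {c} s e with t r c | t′ r c | s r c
val-after s refl | _ | _ | valStay _ = inj₁ refl
val-after s refl | _ | _ | valMove d = inj₂ (refl , d)

-- A freshly written `suc i` fills a dot, and `dot-≤-right` bounds the original right neighbour of
-- that dot. The bound for the box below is the transpose.
left-≤-step : ∀ {i t₀ t t′} → Step (suc i) t t′ → Inv i t₀ t →
              ∀ {r c v u} → t′ r c ≡ val v → t₀ r (suc c) ≡ val u → v ≤ u
left-≤-step s I e f with val-before s e
... | inj₁ e₀             = Inv.left-≤ I e₀ f
... | inj₂ (refl , d , _) = dot-≤-right I d f

Inv-step : ∀ {i t₀ t t′} → Step (suc i) t t′ → Inv i t₀ t → Inv (suc i) t₀ t′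
Inv-step {i} {t₀} {t} {t′} s I = record
  { rowInc  = RowInc-step s rowInc
  ; colInc  = RowInc-step (Step-flip s) colInc
  ; forth   = forth′
  ; back    = back′
  ; above-≤ = left-≤-step (Step-flip s) (Inv-flip I)
  ; left-≤  = left-≤-step s I
  ; shape   = λ {r} {c} e → shape (emptyBefore r c e)
  ; shape⁻  = λ {r} {c} e → emptyAfter r c (shape⁻ e)
  }
  where
  open Inv I

  emptyBefore : ∀ r c → t′ r c ≡ ∅ → t r c ≡ ∅
  emptyBefore r c e with t r c | t′ r c | s r c
  emptyBefore r c refl | _ | _ | empty = refl

  emptyAfter : ∀ r c → t r c ≡ ∅ → t′ r c ≡ ∅
  emptyAfter r c e with t r c | t′ r c | s r c
  emptyAfter r c refl | _ | _ | empty = refl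

  forth′ : ∀ {r c v} → t₀ r c ≡ val v → t′ r c ≡ val v ⊎
           (v ≤ suc i × (Before (λ r₀ → t′ r₀ c ≡ val v) r ⊎ Before (λ c₀ → t′ r c₀ ≡ val v) c))
  forth′ e with forth e
  ... | inj₂ (v≤i , inj₁ (_ , refl , f)) =
    inj₂ (m≤n⇒m≤1+n v≤i , inj₁ (_ , refl , val-persists s v≤i f))
  ... | inj₂ (v≤i , inj₂ (_ , refl , f)) =
    inj₂ (m≤n⇒m≤1+n v≤i , inj₂ (_ , refl , val-persists s v≤i f))
  ... | inj₁ f with val-after s f
  ...   | inj₁ g = inj₁ g
  ...   | inj₂ (refl , inj₁ (_ , refl , d)) =
    inj₂ (≤-refl , inj₁ (_ , refl , dot-fills s d (inj₁ f)))
  ...   | inj₂ (refl , inj₂ (_ , refl , d)) =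
    inj₂ (≤-refl , inj₂ (_ , refl , dot-fills s d (inj₂ f)))

  -- A box reading `suc i` before step `suc i` still holds its original entry, since moved values
  -- are at most `i`.
  untouched : ∀ {r c} → t r c ≡ val (suc i) → t₀ r c ≡ val (suc i)
  untouched e with back e
  ... | inj₁ f       = f
  ... | inj₂ (p , _) = contradiction p (n≮n i)

  back′ : ∀ {r c v} → t′ r c ≡ val v → t₀ r c ≡ val v ⊎ (v ≤ suc i × ValAfter v t₀ r c)
  back′ e with val-before s e
  ... | inj₁ f = Sum.map₂ (map₁ m≤n⇒m≤1+n) (back f)
  ... | inj₂ (refl , _ , a) = inj₂ (≤-refl , Sum.map untouched untouched a)

Inv-slides : ∀ {t} → RowInc 0 t → RowInc 0 (flip t) → ∀ K → Inv K t (slides K t)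
Inv-slides inc incᵀ zero    = Inv-init inc incᵀ
Inv-slides inc incᵀ (suc K) = Inv-step (step-view (suc K) _) (Inv-slides inc incᵀ K)

-- The slide into the antidiagonal r + c = e

-- An increasing tableau on a Young diagram with the staircase `r + c < d` cut out. Strictness is
-- recorded for adjacent boxes only; `closed` and `noDot` later provide the values in between.
record Good (d : ℕ) (U : Tab) : Set where
  field
    noDot  : ∀ {r c} → U r c ≢ ●
    rowInc : RowInc 0 U
    colInc : RowInc 0 (flip U)
    supp   : ∀ {r c} → U r c ≢ ∅ → 0 < r × 0 < c × d ≤ r + c
    closed : ∀ {r c r′ c′} → U r c ≢ ∅ → r′ ≤ r → c′ ≤ c → 0 < r′ → 0 < c′ → d ≤ r′ + c′ →
             U r′ c′ ≢ ∅

Good-flip : ∀ {d U} → Good d U → Good d (flip U)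
Good-flip {d} G = record
  { noDot = noDot ; rowInc = colInc ; colInc = rowInc
  ; supp = λ {r} {c} p → let r>0 , c>0 , d≤ = supp p in c>0 , r>0 , subst (d ≤_) (+-comm c r) d≤
  ; closed = λ {_} {_} {r′} {c′} p r≤ c≤ r>0 c>0 d≤ →
      closed p c≤ r≤ c>0 r>0 (subst (d ≤_) (+-comm r′ c′) d≤) }
  where open Good G

-- Positivity puts the values above the dots, which initially count as ½; the upper bound makes `K`
-- steps enough to push every dot to the outer border.
Bounded : ℕ → Tab → Set
Bounded K U = ∀ {r c v} → U r c ≡ val v → 0 < v × v ≤ K

val≢∅ : ∀ {x v} → x ≡ val v → x ≢ ∅
val≢∅ refl ()

●≢∅ : ∀ {x} → x ≡ ● → x ≢ ∅
●≢∅ refl ()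

is-val : ∀ x → x ≢ ∅ → x ≢ ● → ∃ λ v → x ≡ val v
is-val ∅       p _ = contradiction refl p
is-val ●       _ p = contradiction refl p
is-val (val v) _ _ = v , refl

Good⇒RowStrict : ∀ {d U} → Good d U → RowStrict U
Good⇒RowStrict {d} {U} G {r} {c} e f c<c′ = go _ f c<c′
  where
  open Good G
  go : ∀ c′ {v′} → U r c′ ≡ val v′ → c < c′ → _ < v′
  go (suc c′) f c<c′ with m<1+n⇒m<n∨m≡n c<c′
  ... | inj₂ refl = subst₂ (Lt 0) e f (rowInc r c)
  ... | inj₁ c<c″ =
    let r>0 , c>0 , d≤ = supp (val≢∅ e)
        g≢∅ = closed (val≢∅ f) ≤-refl (n≤1+n c′) r>0 (<-trans c>0 c<c″)
                (≤-trans d≤ (+-monoʳ-≤ r (<⇒≤ c<c″)))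
        _ , g = is-val _ g≢∅ noDot
    in <-trans (go c′ g c<c″) (subst₂ (Lt 0) g f (rowInc r c′))

OnDiagonal : ℕ → ℕ → ℕ → Set
OnDiagonal e r c = 0 < r × 0 < c × r + c ≡ e

Placed : ℕ → Tab → Tab → Set
Placed e U t = ∀ r c → (OnDiagonal e r c × t r c ≡ ●) ⊎ (¬ OnDiagonal e r c × t r c ≡ U r c)

OnDiagonal-flip : ∀ {e r c} → OnDiagonal e r c → OnDiagonal e c r
OnDiagonal-flip {_} {r} {c} (r>0 , c>0 , s) = c>0 , r>0 , trans (+-comm c r) s

Placed-flip : ∀ {e U t} → Placed e U t → Placed e (flip U) (flip t)
Placed-flip P r c with P c r
... | inj₁ (o , x) = inj₁ (OnDiagonal-flip o , x)
... | inj₂ (o , x) = inj₂ (o ∘ OnDiagonal-flip , x)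

strip : Cell → Cell
strip ● = ∅
strip x = x

Stripped : Tab → Tab → Set
Stripped t U = ∀ r c → U r c ≡ strip (t r c)

deleteDots-strips : ∀ t → Stripped t (deleteDots t)
deleteDots-strips t r c with t r c
... | ∅     = refl
... | ●     = refl
... | val _ = refl

strip-val : ∀ x {v} → strip x ≡ val v → x ≡ val v
strip-val (val _) e = e

strip-≢∅ : ∀ x → strip x ≢ ∅ → ∃ λ v → x ≡ val v
strip-≢∅ ∅       p = contradiction refl p
strip-≢∅ ●       p = contradiction refl p
strip-≢∅ (val v) _ = v , refl

strip-≢● : ∀ x → strip x ≢ ●
strip-≢● ∅ ()
strip-≢● ● ()

strip-Lt : ∀ {i} x y → Lt i x y → Lt 0 (strip x) (strip y)
strip-Lt ∅       _       _  = tt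
strip-Lt ●       _       _  = tt
strip-Lt (val _) ∅       _  = tt
strip-Lt (val _) ●       _  = tt
strip-Lt (val _) (val _) lt = lt

-- A dot counts as less than the positive value to its right, has nothing but empty boxes to its
-- left because `U` starts beyond antidiagonal `e`, and is never next to another dot of that
-- antidiagonal.
Placed-RowInc : ∀ {e U t K} → Good (suc e) U → Bounded K U → Placed e U t → RowInc 0 t
Placed-RowInc {e} {U} {t} G B P r c with P r c | P r (suc c)
... | inj₁ ((_ , _ , s) , _) | inj₁ ((_ , _ , s′) , _) =
  contradiction (+-cancelˡ-≡ r _ _ (trans s (sym s′))) (1+n≢n ∘ sym)
... | inj₂ (_ , x) | inj₂ (_ , y) = subst₂ (Lt 0) (sym x) (sym y) (Good.rowInc G r c)
... | inj₁ (_ , x) | inj₂ (_ , y) = subst₂ (Lt 0) (sym x) (sym y) (dot-Lt (U r (suc c)) refl)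
  where
  dot-Lt : ∀ z → U r (suc c) ≡ z → Lt 0 ● z
  dot-Lt ∅       _ = tt
  dot-Lt ●       f = contradiction f (Good.noDot G)
  dot-Lt (val _) f = proj₁ (B f)
... | inj₂ (_ , x) | inj₁ ((_ , _ , s) , y) = subst₂ (Lt 0) (sym x) (sym y) (Lt-dot (U r c) refl)
  where
  outside : U r c ≢ ∅ → ⊥
  outside p = <⇒≱ (proj₂ (proj₂ (Good.supp G p)))
    (subst (r + c ≤_) s (+-monoʳ-≤ r (n≤1+n c)))
  Lt-dot : ∀ z → U r c ≡ z → Lt 0 z ●
  Lt-dot ∅       _ = tt
  Lt-dot ●       f = outside (●≢∅ f)
  Lt-dot (val _) f = ⊥-elim (outside (val≢∅ f))

-- The slide enters only through `Placed`, `Inv` and `Stripped`. All three can be transposed, so the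
-- transposed slide is covered as well.
module _ {e K : ℕ} {U t₀ t U′ : Tab} (G : Good (suc e) U) (B : Bounded K U)
         (P : Placed e U t₀) (I : Inv K t₀ t) (D : Stripped t U′) where
  private module G = Good G
  open Inv I

  private
    placed-val : ∀ {r c v} → U r c ≡ val v → t₀ r c ≡ val v
    placed-val {r} {c} f with P r c
    ... | inj₁ ((_ , _ , s) , _) =
      contradiction (subst (suc e ≤_) s (proj₂ (proj₂ (G.supp (val≢∅ f))))) (n≮n e)
    ... | inj₂ (_ , x) = trans x f

    unplaced-val : ∀ {r c v} → t₀ r c ≡ val v → U r c ≡ val v
    unplaced-val {r} {c} f with P r c
    ... | inj₁ (_ , x) with () ← trans (sym x) f
    ... | inj₂ (_ , x) = trans (sym x) f

    unstripped : ∀ {r c v} → U′ r c ≡ val v → t r c ≡ val v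
    unstripped f = strip-val _ (trans (sym (D _ _)) f)

    stripped : ∀ {r c v} → t r c ≡ val v → U′ r c ≡ val v
    stripped f = trans (D _ _) (cong strip f)

    placed-supp : ∀ {r c} → t₀ r c ≢ ∅ → 0 < r × 0 < c × e ≤ r + c
    placed-supp {r} {c} p with P r c
    ... | inj₁ ((r>0 , c>0 , s) , _) = r>0 , c>0 , ≤-reflexive (sym s)
    ... | inj₂ (_ , x) = let r>0 , c>0 , d≤ = G.supp (p ∘ trans x) in r>0 , c>0 , <⇒≤ d≤

    placed-closed : ∀ {r c r′ c′} → t₀ r c ≢ ∅ → r′ ≤ r → c′ ≤ c → 0 < r′ → 0 < c′ →
                    e ≤ r′ + c′ → t₀ r′ c′ ≢ ∅
    placed-closed {r} {c} {r′} {c′} p r≤ c≤ r>0 c>0 e≤ with P r′ c′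
    ... | inj₁ (_ , x) = ●≢∅ x
    ... | inj₂ (o , x) with P r c
    ...   | inj₁ ((_ , _ , s) , _) =
      contradiction (r>0 , c>0 , ≤-antisym (subst (r′ + c′ ≤_) s (+-mono-≤ r≤ c≤)) e≤) o
    ...   | inj₂ (_ , y) = λ f → G.closed (p ∘ trans y) r≤ c≤ r>0 c>0
      (≤∧≢⇒< e≤ λ s → o (r>0 , c>0 , sym s)) (trans (sym x) f)

    t-bounded : ∀ {r c v} → t r c ≡ val v → 0 < v × v ≤ K
    t-bounded f with back f
    ... | inj₁ g              = B (unplaced-val g)
    ... | inj₂ (_ , inj₁ g)   = B (unplaced-val g)
    ... | inj₂ (_ , inj₂ g)   = B (unplaced-val g)

    -- After step `K` a dot counts as `K` + ½, more than every value, so only empty boxes can follow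
    -- it to the right or below.
    final-dot : ∀ {x y} → x ≡ ● → Lt K x y → (∀ {v} → y ≡ val v → v ≤ K) → y ≡ ∅
    final-dot {y = ∅}     refl lt h = refl
    final-dot {y = ●}     refl lt h = ⊥-elim lt
    final-dot {y = val k} refl lt h = contradiction lt (≤⇒≯ (h refl))

    final-dot-right : ∀ {r c} → t r c ≡ ● → t₀ r (suc c) ≡ ∅
    final-dot-right d = shape (final-dot d (rowInc _ _) (proj₂ ∘ t-bounded))

    final-dot-below : ∀ {r c} → t r c ≡ ● → t₀ (suc r) c ≡ ∅
    final-dot-below d = shape (final-dot d (colInc _ _) (proj₂ ∘ t-bounded))

    stripped-≢∅ : ∀ {r c} → U′ r c ≢ ∅ → ∃ λ v → t r c ≡ val v
    stripped-≢∅ p = strip-≢∅ _ (p ∘ trans (D _ _))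

  slide-Bounded : Bounded K U′
  slide-Bounded = t-bounded ∘ unstripped

  slide-Good : Good e U′
  slide-Good = record
    { noDot  = λ {r} {c} f → strip-≢● (t r c) (trans (sym (D r c)) f)
    ; rowInc = λ r c → subst₂ (Lt 0) (sym (D r c)) (sym (D r (suc c))) (strip-Lt _ _ (rowInc r c))
    ; colInc = λ c r → subst₂ (Lt 0) (sym (D r c)) (sym (D (suc r) c)) (strip-Lt _ _ (colInc c r))
    ; supp   = λ p → placed-supp (val≢∅ (proj₂ (stripped-≢∅ p)) ∘ shape⁻)
    ; closed = closed′
    }
    where
    closed′ : ∀ {r c r′ c′} → U′ r c ≢ ∅ → r′ ≤ r → c′ ≤ c → 0 < r′ → 0 < c′ → e ≤ r′ + c′ →
              U′ r′ c′ ≢ ∅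
    closed′ {r} {c} {r′} {c′} p r≤ c≤ r>0 c>0 e≤ =
      let _ , f = stripped-≢∅ p
          t₀≢∅  = val≢∅ f ∘ shape⁻
          x     = is-val (t r′ c′) (placed-closed t₀≢∅ r≤ c≤ r>0 c>0 e≤ ∘ shape)
                    (no-dot f t₀≢∅)
      in val≢∅ (stripped (proj₂ x))
      where
      -- A surviving dot has nothing below it or to its right, whereas a different box of the shape
      -- weakly south-east of it would force one of these to be nonempty.
      no-dot : ∀ {v} → t r c ≡ val v → t₀ r c ≢ ∅ → t r′ c′ ≢ ●
      no-dot f t₀≢∅ d with m≤n⇒m<n∨m≡n r≤ | m≤n⇒m<n∨m≡n c≤
      ... | inj₁ r< | _ = placed-closed t₀≢∅ r< c≤ (m<n⇒m<1+n r>0) c>0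
        (m≤n⇒m≤1+n e≤) (final-dot-below d)
      ... | inj₂ refl | inj₁ c< = placed-closed t₀≢∅ ≤-refl c< r>0 (m<n⇒m<1+n c>0)
        (≤-trans e≤ (+-monoʳ-≤ r (n≤1+n c′))) (final-dot-right d)
      ... | inj₂ refl | inj₂ refl with () ← trans (sym f) d

  slide-RowSlide : RowSlide U U′
  slide-RowSlide = record
    { strict  = Good⇒RowStrict G
    ; strict′ = Good⇒RowStrict slide-Good
    ; forth   = λ f → forth″ (forth (placed-val f))
    ; back    = λ f → back″ (back (unstripped f))
    ; above-≤ = λ f g → above-≤ (unstripped f) (placed-val g)
    ; above-∃ = above-∃′
    ; below-∃ = below-∃′
    }
    where
    forth″ : ∀ {r c v} → t r c ≡ val v ⊎ (v ≤ K ×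
               (Before (λ r₀ → t r₀ c ≡ val v) r ⊎ Before (λ c₀ → t r c₀ ≡ val v) c)) →
             (∃ λ c₀ → U′ r c₀ ≡ val v) ⊎ (∃ λ r₀ → r ≡ suc r₀ × U′ r₀ c ≡ val v)
    forth″ (inj₁ f)                        = inj₁ (_ , stripped f)
    forth″ (inj₂ (_ , inj₁ (_ , eq , f))) = inj₂ (_ , eq , stripped f)
    forth″ (inj₂ (_ , inj₂ (_ , _ , f)))  = inj₁ (_ , stripped f)

    back″ : ∀ {r c v} → t₀ r c ≡ val v ⊎ (v ≤ K × ValAfter v t₀ r c) →
            (∃ λ c₀ → U r c₀ ≡ val v) ⊎ U (suc r) c ≡ val v
    back″ (inj₁ f)            = inj₁ (_ , unplaced-val f)
    back″ (inj₂ (_ , inj₁ f)) = inj₂ (unplaced-val f)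
    back″ (inj₂ (_ , inj₂ f)) = inj₁ (_ , unplaced-val f)

    -- The value in column `c₀` shows that `(r , c)` lies beyond antidiagonal `e`, and the value
    -- below then makes it part of the shape. By `final-dot-below` it is not a surviving dot.
    above-∃′ : ∀ {r c₀ c v u} → U′ r c₀ ≡ val v → U (suc r) c ≡ val u → c₀ < c →
               ∃ λ v′ → U′ r c ≡ val v′
    above-∃′ {r} {c₀} {c} f g c₀<c =
      let r>0 , c₀>0 , e≤ = Good.supp slide-Good (val≢∅ f)
          g₀   = val≢∅ (placed-val g)
          t₀≢∅ = placed-closed g₀ (n≤1+n r) ≤-refl r>0 (<-trans c₀>0 c₀<c)
                   (≤-trans e≤ (+-monoʳ-≤ r (<⇒≤ c₀<c)))
          _ , h = is-val (t r c) (t₀≢∅ ∘ shape) (g₀ ∘ final-dot-below)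
      in _ , stripped h

    below-∃′ : ∀ {r c c₀ v u} → U′ r c ≡ val v → U (suc r) c₀ ≡ val u → c < c₀ →
               ∃ λ u′ → U (suc r) c ≡ val u′
    below-∃′ {r} {c} {c₀} f g c<c₀ =
      let r>0 , c>0 , e≤ = Good.supp slide-Good (val≢∅ f)
      in is-val _ (G.closed (val≢∅ g) ≤-refl (<⇒≤ c<c₀) (m<n⇒m<1+n r>0) c>0 (s≤s e≤)) G.noDot

-- Sliding through the whole staircase.

IsDiagonal : ℕ → (ℕ → ℕ → Bool) → Set
IsDiagonal e B = ∀ r c → (OnDiagonal e r c × B r c ≡ true) ⊎ (¬ OnDiagonal e r c × B r c ≡ false)

placeDots-Placed : ∀ {e B} U → IsDiagonal e B → Placed e U (placeDots B U)
placeDots-Placed {B = B} U H r c with H r c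
... | inj₁ (o , x) = inj₁ (o , cong (if_then ● else U r c) x)
... | inj₂ (o , x) = inj₂ (o , cong (if_then ● else U r c) x)

_≈ₛ_ : Tab → Tab → Set
U ≈ₛ V = U ≈ₚ V × flip U ≈ₚ flip V

jdtB-invariant : ∀ {e B K U} → IsDiagonal e B → Good (suc e) U → Bounded K U →
                 Good e (jdtB B K U) × Bounded K (jdtB B K U) × U ≈ₛ jdtB B K U
jdtB-invariant {e} {B} {K} {U} H G Bd =
  slide-Good G Bd P I D , slide-Bounded G Bd P I D ,
  RowSlide⇒≈ₚ (slide-RowSlide G Bd P I D) ,
  RowSlide⇒≈ₚ (slide-RowSlide (Good-flip G) Bd (Placed-flip P) (Inv-flip I) (flip D))
  where
  P : Placed e U (placeDots B U)
  P = placeDots-Placed U H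
  I : Inv K (placeDots B U) (slides K (placeDots B U))
  I = Inv-slides (Placed-RowInc G Bd P) (Placed-RowInc (Good-flip G) Bd (Placed-flip P)) K
  D : Stripped (slides K (placeDots B U)) (jdtB B K U)
  D = deleteDots-strips (slides K (placeDots B U))

-- Entry `suc i` sits where `r + c` is `i + 2`, and `suc i ≤ m` ensures that the staircase contains
-- this antidiagonal whole.
minTab-diagonal : ∀ m i → suc i ≤ m →
                  IsDiagonal (suc (suc i)) (λ r c → isVal (suc i) (minTab m r c))
minTab-diagonal m i i<m zero    c       = inj₂ ((λ { (() , _) }) , refl)
minTab-diagonal m i i<m (suc r) zero    = inj₂ ((λ { (_ , () , _) }) , refl)
minTab-diagonal m i i<m (suc r) (suc c) with suc r + c ≤ᵇ m in e₁
... | false = inj₂ ((λ { (_ , _ , s) → false≢true e₁ (Equivalence.to T-≡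
        (≤⇒≤ᵇ (subst (_≤ m) (sym (suc-injective (trans (cong suc (sym (+-suc r c))) s))) i<m))) }) , refl)
... | true with suc r + c ≡ᵇ suc i in e₂
...   | true  = inj₁ ((s≤s z≤n , s≤s z≤n , cong suc (trans (+-suc r c)
          (≡ᵇ⇒≡ (suc r + c) (suc i) (Equivalence.from T-≡ e₂)))) , refl)
...   | false = inj₂ ((λ { (_ , _ , s) → false≢true e₂ (Equivalence.to T-≡
          (≡⇒≡ᵇ (suc r + c) (suc i) (suc-injective (trans (cong suc (sym (+-suc r c))) s)))) }) , refl)

-- Sliding into the boxes of entry `suc i` lowers the inner border of `U` from antidiagonal `i + 3`
-- to `i + 2`, where the next slide expects it.
jdtT-invariant : ∀ m i {K U} → i ≤ m → Good (suc (suc i)) U → Bounded K U →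
                 U ≈ₛ jdtT (minTab m) i K U
jdtT-invariant m zero    i≤m G B = (λ _ _ _ → id , id) , (λ _ _ _ → id , id)
jdtT-invariant m (suc i) i≤m G B =
  let G′ , B′ , (p , pᵀ) = jdtB-invariant (minTab-diagonal m i i≤m) G B
      q , qᵀ             = jdtT-invariant m i (<⇒≤ i≤m) G′ B′
  in ≈ₚ-trans p q , ≈ₚ-trans pᵀ qᵀ

-- Words

<-length-toList : ∀ {n} (w : Vec ℕ n) {i} → i < n → i < length (toList w)
<-length-toList w = subst (_ <_) (sym (length-toList w))

wordTab-view : ∀ n w r c → wordTab n w r c ≡ ∅ ⊎
  (∃ λ i → i < n × r ≡ n ∸ i × c ≡ suc i × wordTab n w r c ≡ val (nth (toList w) i))
wordTab-view n w r zero = inj₁ refl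
wordTab-view n w r (suc i) with i <ᵇ n in e₁ | r ≡ᵇ n ∸ i in e₂
... | false | _     = inj₁ refl
... | true  | false = inj₁ refl
... | true  | true  = inj₂ (i , <ᵇ⇒< i n (Equivalence.from T-≡ e₁) ,
  ≡ᵇ⇒≡ r (n ∸ i) (Equivalence.from T-≡ e₂) , refl , refl)

wordTab-val : ∀ n w r c {v} → wordTab n w r c ≡ val v →
              ∃ λ i → i < n × r ≡ n ∸ i × c ≡ suc i × v ≡ nth (toList w) i
wordTab-val n w r c e with wordTab-view n w r c
... | inj₁ f with () ← trans (sym e) f
... | inj₂ (i , i<n , r≡ , c≡ , f) = i , i<n , r≡ , c≡ , val-injective (trans (sym e) f)

wordTab-cell : ∀ n w {i} → i < n → wordTab n w (n ∸ i) (suc i) ≡ val (nth (toList w) i)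
wordTab-cell n w {i} i<n
  rewrite Equivalence.to T-≡ (<⇒<ᵇ i<n) | Equivalence.to T-≡ (≡⇒≡ᵇ (n ∸ i) (n ∸ i) refl) = refl

wordTab-diagonal : ∀ n w r c → wordTab n w r c ≢ ∅ → OnDiagonal (suc n) r c
wordTab-diagonal n w r c p with wordTab-view n w r c
... | inj₁ f = contradiction f p
... | inj₂ (i , i<n , refl , refl , _) =
  m<n⇒0<n∸m i<n , s≤s z≤n , trans (+-suc (n ∸ i) i) (cong suc (m∸n+n≡m (<⇒≤ i<n)))

-- Neighbouring boxes lie on different antidiagonals, so one of them is empty.
Diagonal⇒RowInc : ∀ {d U} → (∀ r c → U r c ≢ ∅ → OnDiagonal d r c) → RowInc 0 U
Diagonal⇒RowInc {d} {U} H r c = go (U r c) (U r (suc c)) refl refl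
  where
  both : U r c ≢ ∅ → U r (suc c) ≢ ∅ → ⊥
  both p q = 1+n≢n (+-cancelˡ-≡ r _ _ (trans (proj₂ (proj₂ (H r (suc c) q))) (sym (proj₂ (proj₂ (H r c p))))))
  go : ∀ x y → U r c ≡ x → U r (suc c) ≡ y → Lt 0 x y
  go ∅       y       e f = tt
  go ●       ∅       e f = tt
  go ●       ●       e f = both (●≢∅ e) (●≢∅ f)
  go ●       (val _) e f = ⊥-elim (both (●≢∅ e) (val≢∅ f))
  go (val _) ∅       e f = tt
  go (val _) ●       e f = ⊥-elim (both (val≢∅ e) (●≢∅ f))
  go (val _) (val _) e f = ⊥-elim (both (val≢∅ e) (val≢∅ f))

wordTab-Good : ∀ n w → Good (suc n) (wordTab n w)
wordTab-Good n w = record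
  { noDot  = λ {r} {c} → noDot r c
  ; rowInc = Diagonal⇒RowInc (wordTab-diagonal n w)
  ; colInc = Diagonal⇒RowInc λ c r → OnDiagonal-flip ∘ wordTab-diagonal n w r c
  ; supp   = λ {r} {c} p →
      let r>0 , c>0 , s = wordTab-diagonal n w r c p in r>0 , c>0 , ≤-reflexive (sym s)
  ; closed = closed
  }
  where
  noDot : ∀ r c → wordTab n w r c ≢ ●
  noDot r c e with wordTab-view n w r c
  ... | inj₁ f with () ← trans (sym e) f
  ... | inj₂ (_ , _ , _ , _ , f) with () ← trans (sym e) f

  closed : ∀ {r c r′ c′} → wordTab n w r c ≢ ∅ → r′ ≤ r → c′ ≤ c → 0 < r′ → 0 < c′ →
           suc n ≤ r′ + c′ → wordTab n w r′ c′ ≢ ∅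
  closed {r} {c} {r′} {c′} p r≤ c≤ _ _ d≤ with wordTab-diagonal n w r c p
  ... | _ , _ , s with m≤n⇒m<n∨m≡n r≤ | m≤n⇒m<n∨m≡n c≤
  ...   | inj₁ r<   | _         = contradiction (subst (r′ + c′ <_) s (+-mono-<-≤ r< c≤)) (≤⇒≯ d≤)
  ...   | inj₂ refl | inj₁ c<   = contradiction (subst (r′ + c′ <_) s (+-monoʳ-< r c<)) (≤⇒≯ d≤)
  ...   | inj₂ refl | inj₂ refl = p

nth-≤-maxList : ∀ xs i → nth xs i ≤ maxList xs
nth-≤-maxList []       i       = z≤n
nth-≤-maxList (x ∷ xs) zero    = m≤m⊔n x (maxList xs)
nth-≤-maxList (x ∷ xs) (suc i) = ≤-trans (nth-≤-maxList xs i) (m≤n⊔m x (maxList xs))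

nth-All : ∀ {n} {P : ℕ → Set} {w : Vec ℕ n} → All P w → ∀ {i} → i < n → P (nth (toList w) i)
nth-All (p ∷ ps) {zero}  _         = p
nth-All (p ∷ ps) {suc i} (s≤s i<n) = nth-All ps i<n

wordTab-Bounded : ∀ n w → All (λ x → 1 ≤ x) w → Bounded (maxList (toList w)) (wordTab n w)
wordTab-Bounded n w pos {r} {c} e with wordTab-val n w r c e
... | i , i<n , _ , _ , refl = nth-All pos i<n , nth-≤-maxList (toList w) i

drop-nth : ∀ xs {i} → i < length xs → drop i xs ≡ nth xs i ∷ drop (suc i) xs
drop-nth (x ∷ xs) {zero}  _         = refl
drop-nth (x ∷ xs) {suc i} (s≤s i<n) = drop-nth xs i<n

nth∷-⊆-drop : ∀ {xs s i j} → i < length xs → j ≤ i → s ⊆ drop (suc i) xs → nth xs i ∷ s ⊆ drop j xs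
nth∷-⊆-drop {xs} {s} {i} i<n j≤i σ =
  ⊆-trans (subst (nth xs i ∷ s ⊆_) (sym (drop-nth xs i<n)) (refl ∷ σ)) (drop⁺-≥ {xs = xs} j≤i)

InRange : ℕ → ℕ → ℕ → Set
InRange a b x = a ≤ x × x ≤ b

-- The interval is a condition on `s` and not a restriction of `xs`, to match the value bounds of a
-- path.
Subsequence : (ℕ → ℕ → Set) → (a b k : ℕ) → List ℕ → Set
Subsequence R a b k xs =
  ∃ λ s → s ⊆ xs × AllPairs R s × ListAll.All (InRange a b) s × length s ≡ k

module _ (n : ℕ) (w : Vec ℕ n) where
  private
    xs = toList w
    U  = wordTab n w

    Reads : ℕ → List ℕ → Set
    Reads j ys = ∀ i → i < length ys → U (n ∸ (j + i)) (suc (j + i)) ≡ val (nth ys i)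

    Reads-head : ∀ {j x ys} → Reads j (x ∷ ys) → U (n ∸ j) (suc j) ≡ val x
    Reads-head {j} {x} H = subst (λ m → U (n ∸ m) (suc m) ≡ val x) (+-identityʳ j) (H 0 (s≤s z≤n))

    Reads-tail : ∀ {j x ys} → Reads j (x ∷ ys) → Reads (suc j) ys
    Reads-tail {j} {ys = ys} H i i< =
      subst (λ m → U (n ∸ m) (suc m) ≡ val (nth ys i)) (+-suc j i) (H (suc i) (s≤s i<))

    reads : Reads 0 xs
    reads i i< = wordTab-cell n w (subst (i <_) (length-toList w) i<)

  increasing⇒path-from : ∀ {a b s ys} j → Reads j ys → s ⊆ ys → AllPairs _<_ s →
                         ListAll.All (InRange a b) s → Path b U (n ∸ j) a (length s)
  increasing⇒path-from j H [] [] [] = []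
  increasing⇒path-from j H (_ ∷ʳ σ) <s as =
    weaken (∸-monoʳ-≤ n (n≤1+n j)) ≤-refl (increasing⇒path-from (suc j) (Reads-tail H) σ <s as)
  increasing⇒path-from j H (refl ∷ σ) (x<s ∷ <s) ((a≤x , x≤b) ∷ as) =
    cons (Reads-head H) ≤-refl a≤x x≤b (weaken (∸-monoʳ-≤ n (n≤1+n j)) ≤-refl
      (increasing⇒path-from (suc j) (Reads-tail H) σ <s
        (ListAll.zipWith (λ (x<y , _ , y≤b) → x<y , y≤b) (x<s , as))))

  increasing⇒path : ∀ {a b k} → Subsequence _<_ a b k xs → HasPath a b k U
  increasing⇒path (_ , σ , <s , as , refl) = _ , increasing⇒path-from 0 reads σ <s as

  -- The hypothesis says that every box still open to the path is at position `j` or later. It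
  -- survives a step to position `i`: the row bound excludes earlier positions, the strict increase
  -- of values excludes `i` itself.
  path⇒increasing-from : ∀ {b r l k} j →
    (∀ i → i < n → n ∸ i ≤ r → l ≤ nth xs i → j ≤ i) →
    Path b U r l k → Subsequence _<_ l b k (drop j xs)
  path⇒increasing-from j H [] = [] , minimum _ , [] , [] , refl
  path⇒increasing-from {b} j H (cons {r′ = r′} {c} e p q v≤b π) with wordTab-val n w r′ c e
  ... | i , i<n , refl , refl , refl =
    let s , σ , <s , as , eq = path⇒increasing-from (suc i) later π
    in nth xs i ∷ s , nth∷-⊆-drop (<-length-toList w i<n) (H i i<n p q) σ ,
       ListAll.map proj₁ as ∷ <s ,
       (q , v≤b) ∷ ListAll.map (λ (v<y , y≤b) → <⇒≤ (≤-<-trans q v<y) , y≤b) as , cong suc eq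
    where
    later : ∀ i′ → i′ < n → n ∸ i′ ≤ n ∸ i → suc (nth xs i) ≤ nth xs i′ → suc i ≤ i′
    later i′ i′<n rows values with <-cmp i i′
    ... | tri< i<i′ _ _ = i<i′
    ... | tri≈ _ refl _ = contradiction values (n≮n _)
    ... | tri> _ _ i>i′ = contradiction rows (<⇒≱ (∸-monoʳ-< i>i′ (<⇒≤ i<n)))

  path⇒increasing : ∀ {a b k} → HasPath a b k U → Subsequence _<_ a b k xs
  path⇒increasing (_ , π) = path⇒increasing-from 0 (λ _ _ _ _ → z≤n) π

  -- In the transpose rows follow positions, so a path runs backwards through the word. As letters
  -- are read left to right, each new, smaller one goes in front of the path built so far; the last
  -- hypothesis provides that path with a lower bound above each letter still to be taken.
  decreasing⇒path-onto : ∀ {a b s ys k} j → Reads j ys → s ⊆ ys → AllPairs _>_ s →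
    ListAll.All (InRange a b) s → Path b (flip U) j a k →
    ListAll.All (λ x → Path b (flip U) j (suc x) k) s → HasPath a b (length s + k) (flip U)
  decreasing⇒path-onto j H [] [] [] π _ = _ , π
  decreasing⇒path-onto j H (_ ∷ʳ σ) >s as π πs =
    decreasing⇒path-onto (suc j) (Reads-tail H) σ >s as (weaken (n≤1+n j) ≤-refl π)
      (ListAll.map (weaken (n≤1+n j) ≤-refl) πs)
  decreasing⇒path-onto {a} {b} {x ∷ s} {k = k} j H (refl ∷ σ) (x>s ∷ >s) ((a≤x , x≤b) ∷ as) π (πx ∷ _) =
    subst (λ m → HasPath a b m (flip U)) (+-suc (length s) k)
      (decreasing⇒path-onto (suc j) (Reads-tail H) σ >s as (longer a≤x) (ListAll.map longer x>s))
    where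
    longer : ∀ {l} → l ≤ x → Path b (flip U) (suc j) l (suc k)
    longer l≤x = cons {c = n ∸ j} (Reads-head H) ≤-refl l≤x x≤b (weaken (n≤1+n j) ≤-refl πx)

  decreasing⇒path : ∀ {a b k} → Subsequence _>_ a b k xs → HasPath a b k (flip U)
  decreasing⇒path {a} {b} (s , σ , >s , as , refl) =
    subst (λ m → HasPath a b m (flip U)) (+-identityʳ (length s))
      (decreasing⇒path-onto 0 reads σ >s as [] (ListAll.map (λ _ → []) as))

  -- The path meets the letters from right to left; `s` collects those met so far, all less than `l`
  -- and at positions from `j` on.
  path⇒decreasing-onto : ∀ {a b r l k s} j →
    (∀ i → i < n → suc i ≤ r → l ≤ nth xs i → suc i ≤ j) →
    s ⊆ drop j xs → AllPairs _>_ s → ListAll.All (InRange a b) s → ListAll.All (_< l) s → a ≤ l →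
    Path b (flip U) r l k → Subsequence _>_ a b (k + length s) xs
  path⇒decreasing-onto {s = s} j H σ >s as s<l a≤l [] =
    s , ⊆-trans σ (drop⁺-≥ {m = j} {xs = xs} z≤n) , >s , as , refl
  path⇒decreasing-onto {a} {b} {s = s} j H σ >s as s<l a≤l (cons {k = k} {c′} {r′} e p q v≤b π)
    with wordTab-val n w r′ c′ e
  ... | i , i<n , refl , refl , refl =
    subst (λ m → Subsequence _>_ a b m xs) (+-suc k (length s))
      (path⇒decreasing-onto i earlier
        (nth∷-⊆-drop (<-length-toList w i<n) ≤-refl (⊆-trans σ (drop⁺-≥ {xs = xs} (H i i<n p q))))
        (ListAll.map (λ y<l → <-≤-trans y<l q) s<l ∷ >s) ((≤-trans a≤l q , v≤b) ∷ as)
        (≤-refl ∷ ListAll.map (λ y<l → m<n⇒m<1+n (<-≤-trans y<l q)) s<l)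
        (m≤n⇒m≤1+n (≤-trans a≤l q)) π)
    where
    earlier : ∀ i′ → i′ < n → suc i′ ≤ suc i → suc (nth xs i) ≤ nth xs i′ → suc i′ ≤ i
    earlier i′ _ (s≤s i′≤i) values = ≤∧≢⇒< i′≤i λ { refl → n≮n _ values }

  path⇒decreasing : ∀ {a b k} → HasPath a b k (flip U) → Subsequence _>_ a b k xs
  path⇒decreasing {a} {b} {k} (_ , π) =
    subst (λ m → Subsequence _>_ a b m xs) (+-identityʳ k)
      (path⇒decreasing-onto n (λ _ i<n _ _ → i<n) (minimum _) [] [] [] ≤-refl π)

-- `lis` and `lds` as maxima over subsequences.

⊆⇒∈-subsequences : ∀ {s xs} → s ⊆ xs → s ∈ subsequences xs
⊆⇒∈-subsequences []         = here refl
⊆⇒∈-subsequences (_ ∷ʳ σ)   = ∈-++⁺ʳ _ (⊆⇒∈-subsequences σ)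
⊆⇒∈-subsequences (refl ∷ σ) = ∈-++⁺ˡ (∈-map⁺ _ (⊆⇒∈-subsequences σ))

∈-subsequences⇒⊆ : ∀ {s} xs → s ∈ subsequences xs → s ⊆ xs
∈-subsequences⇒⊆ []       (here refl) = []
∈-subsequences⇒⊆ (x ∷ xs) s∈ with ∈-++⁻ (map (x ∷_) (subsequences xs)) s∈
... | inj₂ s∈′ = x ∷ʳ ∈-subsequences⇒⊆ xs s∈′
... | inj₁ s∈′ with ∈-map⁻ (x ∷_) s∈′
...   | _ , s∈″ , refl = refl ∷ ∈-subsequences⇒⊆ xs s∈″

∈⇒≤-maxList : ∀ {x xs} → x ∈ xs → x ≤ maxList xs
∈⇒≤-maxList {xs = y ∷ ys} (here refl) = m≤m⊔n y (maxList ys)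
∈⇒≤-maxList {xs = y ∷ ys} (there x∈)  = ≤-trans (∈⇒≤-maxList x∈) (m≤n⊔m y (maxList ys))

maxList-attained : ∀ xs → maxList xs ≡ 0 ⊎ maxList xs ∈ xs
maxList-attained []       = inj₁ refl
maxList-attained (x ∷ xs) with ⊔-sel x (maxList xs) | maxList-attained xs
... | inj₁ e | _       = inj₂ (here e)
... | inj₂ e | inj₁ f  = inj₁ (trans e f)
... | inj₂ e | inj₂ m∈ = inj₂ (there (subst (_∈ xs) (sym e) m∈))

-- Both `lis` and `lds` unfold to this with their respective tests, so one argument serves both.
longest : (List ℕ → Bool) → List ℕ → ℕ
longest ok xs = maxList (map length (filter (λ s → T? (ok s)) (subsequences xs)))

T-InRange : ∀ a b {x} → T ((a ≤ᵇ x) ∧ (x ≤ᵇ b)) → InRange a b x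
T-InRange a b {x} t = let p , q = Equivalence.to T-∧ t in ≤ᵇ⇒≤ a x p , ≤ᵇ⇒≤ x b q

InRange-T : ∀ a b {x} → InRange a b x → T ((a ≤ᵇ x) ∧ (x ≤ᵇ b))
InRange-T a b (p , q) = Equivalence.from T-∧ (≤⇒≤ᵇ p , ≤⇒≤ᵇ q)

module _ {R : ℕ → ℕ → Set} (ok : List ℕ → Bool)
         (sound : ∀ s → T (ok s) → AllPairs R s) (complete : ∀ {s} → AllPairs R s → T (ok s))
         (a b : ℕ) where
  private
    ok? = λ s → T? (ok s)
    in? = λ x → T? ((a ≤ᵇ x) ∧ (x ≤ᵇ b))

  ≤-longest : ∀ {k xs} → Subsequence R a b k xs → k ≤ longest ok (restrict a b xs)
  ≤-longest {xs = xs} (s , σ , Rs , as , refl) =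
    ∈⇒≤-maxList (∈-map⁺ length (∈-filter⁺ ok? (⊆⇒∈-subsequences σ′) (complete Rs)))
    where
    σ′ : s ⊆ restrict a b xs
    σ′ = subst (_⊆ restrict a b xs) (filter-all in? (ListAll.map (InRange-T a b) as))
           (filter⁺ in? in? (λ { refl t → t }) σ)

  longest-attained : ∀ xs → Subsequence R a b (longest ok (restrict a b xs)) xs
  longest-attained xs
    with maxList-attained (map length (filter ok? (subsequences (restrict a b xs))))
  -- A maximum of 0 may be the default of `maxList` and not an attained length; the empty
  -- subsequence witnesses it in any case.
  ... | inj₁ e = [] , minimum xs , [] , [] , sym e
  ... | inj₂ m∈ with ∈-map⁻ length m∈
  ...   | s , s∈ , e with ∈-filter⁻ ok? s∈
  ...     | s∈′ , t =
    let σ = ∈-subsequences⇒⊆ (restrict a b xs) s∈′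
    in s , ⊆-trans σ (filter-⊆ in? xs) , sound s t ,
       All-resp-⊆ σ (ListAll.map (T-InRange a b) (all-filter in? xs)) , sym e

  longest-≤ : ∀ {xs ys} → (∀ {k} → Subsequence R a b k xs → Subsequence R a b k ys) →
              longest ok (restrict a b xs) ≤ longest ok (restrict a b ys)
  longest-≤ {xs} H = ≤-longest (H (longest-attained xs))

strictlyInc-sound : ∀ s → T (strictlyInc s) → Linked _<_ s
strictlyInc-sound []          _ = []
strictlyInc-sound (x ∷ [])    _ = [-]
strictlyInc-sound (x ∷ y ∷ s) t =
  let p , q = Equivalence.to T-∧ t in <ᵇ⇒< x y p ∷ strictlyInc-sound (y ∷ s) q

strictlyInc-complete : ∀ {s} → Linked _<_ s → T (strictlyInc s)
strictlyInc-complete []       = tt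
strictlyInc-complete [-]      = tt
strictlyInc-complete (p ∷ ps) = Equivalence.from T-∧ (<⇒<ᵇ p , strictlyInc-complete ps)

strictlyDec-sound : ∀ s → T (strictlyDec s) → Linked _>_ s
strictlyDec-sound []          _ = []
strictlyDec-sound (x ∷ [])    _ = [-]
strictlyDec-sound (x ∷ y ∷ s) t =
  let p , q = Equivalence.to T-∧ t in <ᵇ⇒< y x p ∷ strictlyDec-sound (y ∷ s) q

strictlyDec-complete : ∀ {s} → Linked _>_ s → T (strictlyDec s)
strictlyDec-complete []       = tt
strictlyDec-complete [-]      = tt
strictlyDec-complete (p ∷ ps) = Equivalence.from T-∧ (<⇒<ᵇ p , strictlyDec-complete ps)

lis-≤ : ∀ a b {xs ys} → (∀ {k} → Subsequence _<_ a b k xs → Subsequence _<_ a b k ys) →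
        lis (restrict a b xs) ≤ lis (restrict a b ys)
lis-≤ a b = longest-≤ strictlyInc
  (λ s → Linked⇒AllPairs <-trans ∘ strictlyInc-sound s) (strictlyInc-complete ∘ AllPairs⇒Linked) a b

lds-≤ : ∀ a b {xs ys} → (∀ {k} → Subsequence _>_ a b k xs → Subsequence _>_ a b k ys) →
        lds (restrict a b xs) ≤ lds (restrict a b ys)
lds-≤ a b = longest-≤ strictlyDec
  (λ s → Linked⇒AllPairs (flip <-trans) ∘ strictlyDec-sound s) (strictlyDec-complete ∘ AllPairs⇒Linked) a b

-- Comparison of two words with the same image under `𝒲`.

𝒲-invariant : ∀ m w → All (λ x → 1 ≤ x) w → wordTab (suc m) w ≈ₛ 𝒲 (suc m) w
𝒲-invariant m w pos =
  jdtT-invariant m m ≤-refl (wordTab-Good (suc m) w) λ {r} {c} → wordTab-Bounded (suc m) w pos {r} {c}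

-- A subsequence of `u` becomes a path of its tableau, then of the common image under `𝒲`, then of
-- the tableau of `w`, where it is read back. Exchanging `u` and `w` gives the other inequality.
𝒲-≡⇒≤ : ∀ m (u w : Vec ℕ (suc m)) → All (λ x → 1 ≤ x) u → All (λ x → 1 ≤ x) w →
  (∀ r c → 𝒲 (suc m) u r c ≡ 𝒲 (suc m) w r c) → ∀ a b →
  lis (restrict a b (toList u)) ≤ lis (restrict a b (toList w)) ×
  lds (restrict a b (toList u)) ≤ lds (restrict a b (toList w))
𝒲-≡⇒≤ m u w pu pw eq a b =
  lis-≤ a b (path⇒increasing (suc m) w ∘ proj₂ (I _ _ _) ∘ map₂ (path-cong eq) ∘
             proj₁ (J _ _ _) ∘ increasing⇒path (suc m) u) ,
  lds-≤ a b (path⇒decreasing (suc m) w ∘ proj₂ (Iᵀ _ _ _) ∘ map₂ (path-cong (flip eq)) ∘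
             proj₁ (Jᵀ _ _ _) ∘ decreasing⇒path (suc m) u)
  where
  I  = proj₁ (𝒲-invariant m w pw)
  Iᵀ = proj₂ (𝒲-invariant m w pw)
  J  = proj₁ (𝒲-invariant m u pu)
  Jᵀ = proj₂ (𝒲-invariant m u pu)

theorem2p13 : (n : ℕ) → 1 ≤ n → (u w : Vec ℕ n) →
    All (λ x → 1 ≤ x) u → All (λ x → 1 ≤ x) w →
    (∀ (r c : ℕ) → 𝒲 n u r c ≡ 𝒲 n w r c) →
    toList u ∼rid toList w
theorem2p13 (suc m) _ u w pu pw eq a b =
  let p , q   = 𝒲-≡⇒≤ m u w pu pw eq a b
      p′ , q′ = 𝒲-≡⇒≤ m w u pw pu (λ r c → sym (eq r c)) a b
  in ≤-antisym p p′ , ≤-antisym q q′
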